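{- Let $A$ be a bounded pseudo-BCK algebra, let $s$ be a Bosbach state on $A$ and let $K=\mathrm{Ker}(s)$. Then $(A/K,\oplus,{}^-,0/K)$, where $$a/K\oplus b/K=(a^{\sim}\rightarrow b)/K\quad\text{and}\quad (a/K)^-=a^-/K,$$ is an archimedean MV-algebra, and the map $\hat s(a/K):=s(a)$ is an MV-state on this MV-algebra.
   Context: A pseudo-BCK algebra is a structure $(A,\le,\rightarrow,\rightsquigarrow,1)$ with $\le$ a binary relation, $\rightarrow,\rightsquigarrow$ binary operations and $1\in A$, such that for all $x,y,z\in A$: $x\rightarrow y\le (y\rightarrow z)\rightsquigarrow(x\rightarrow z)$ and $x\rightsquigarrow y\le (y\rightsquigarrow z)\rightarrow(x\rightsquigarrow z)$; $x\le (x\rightarrow y)\rightsquigarrow y$ and $x\le (x\rightsquigarrow y)\rightarrow y$; $x\le x$; $x\le 1$; $x\le y$ and $y\le x$ imply $x=y$; $x\le y$ iff $x\rightarrow y=1$ iff $x\rightsquigarrow y=1$. Then $\le$ is a partial order. $A$ is bounded if it has a least element $0$; then $x^-:=x\rightarrow 0$, $x^\sim:=x\rightsquigarrow 0$. A filter of $A$ is a set $F$ with $1\in F$ such that $a\in F$, $a\rightarrow b\in F$ imply $b\in F$; it is normal if $a\rightarrow b\in F\iff a\rightsquigarrow b\in F$. For a normal filter $F$, the relation $a\,\Theta_F\, b\iff a\rightarrow b\in F$ and $b\rightarrow a\in F$ is a congruence and $A/F$ denotes the quotient pseudo-BCK algebra with classes $a/F$. A Bosbach state on a bounded pseudo-BCK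 algebra is a map $s:A\to[0,1]$ with $s(x)+s(x\rightarrow y)=s(y)+s(y\rightarrow x)$, $s(x)+s(x\rightsquigarrow y)=s(y)+s(y\rightsquigarrow x)$ for all $x,y$, $s(0)=0$, $s(1)=1$; its kernel is $\mathrm{Ker}(s)=\{a\in A: s(a)=1\}$ (a normal filter). An MV-algebra is an algebra $(M,\oplus,{}^-,0)$ with $\oplus$ commutative and associative, $x\oplus 0=x$, $x\oplus 0^-=0^-$, $x^{ -- }=x$, $y\oplus(y\oplus x^-)^-=x\oplus(x\oplus y^-)^-$; it is archimedean if $nx\le x^-$ for all $n\in\mathbb N$ implies $x=0$ (where $nx=x\oplus\cdots\oplus x$, $n$ times). An MV-state is a map $\mu:M\to[0,1]$ with $\mu(0^-)=1$ and $\mu(a\oplus b)=\mu(a)+\mu(b)$ whenever $(a^-\oplus b^-)^-=0$. -}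

module Defs where

open import Data.Nat using (ℕ; zero; suc)
open import Data.Sum using (_⊎_)
open import Data.Product using (Σ; ∃; _×_; _,_)
open import Relation.Binary.PropositionalEquality using (_≡_; _≢_)
open import Relation.Binary.Structures using (IsEquivalence)
open import Relation.Nullary using (¬_)

-- The real numbers, given axiomatically as a complete ordered field
-- (any two models are isomorphic, so quantifying over models is
-- the same as working with ℝ).

record RealNumbers : Set₁ where
  infixl 6 _+_
  infixl 7 _*_
  infix 4 _≤_
  field
    ℝ : Set
    _+_ _*_ : ℝ → ℝ → ℝ
    -_ : ℝ → ℝ
    0ℝ 1ℝ : ℝ
    _≤_ : ℝ → ℝ → Set
    +-assoc : ∀ x y z → (x + y) + z ≡ x + (y + z)
    +-comm : ∀ x y → x + y ≡ y + x
    +-identityʳ : ∀ x → x + 0ℝ ≡ x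
    +-inverseʳ : ∀ x → x + (- x) ≡ 0ℝ
    *-assoc : ∀ x y z → (x * y) * z ≡ x * (y * z)
    *-comm : ∀ x y → x * y ≡ y * x
    *-identityʳ : ∀ x → x * 1ℝ ≡ x
    distribˡ : ∀ x y z → x * (y + z) ≡ x * y + x * z
    0≢1 : 0ℝ ≢ 1ℝ
    *-inverse : ∀ x → x ≢ 0ℝ → Σ ℝ (λ y → x * y ≡ 1ℝ)
    ≤-refl : ∀ x → x ≤ x
    ≤-trans : ∀ {x y z} → x ≤ y → y ≤ z → x ≤ z
    ≤-antisym : ∀ {x y} → x ≤ y → y ≤ x → x ≡ y
    ≤-total : ∀ x y → (x ≤ y) ⊎ (y ≤ x)
    +-mono-≤ : ∀ {x y} z → x ≤ y → x + z ≤ y + z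
    *-nonneg : ∀ {x y} → 0ℝ ≤ x → 0ℝ ≤ y → 0ℝ ≤ x * y
    sup : (P : ℝ → Set) → Σ ℝ P → Σ ℝ (λ b → ∀ x → P x → x ≤ b) →
          Σ ℝ (λ u → (∀ x → P x → x ≤ u) ×
                     (∀ b → (∀ x → P x → x ≤ b) → u ≤ b))

record PseudoBCK : Set₁ where
  infixr 5 _⇒_ _⇝_
  infix 4 _≼_
  field
    A : Set
    _≼_ : A → A → Set
    _⇒_ _⇝_ : A → A → A
    𝟙 : A
    ax-⇒ : ∀ x y z → (x ⇒ y) ≼ ((y ⇒ z) ⇝ (x ⇒ z))
    ax-⇝ : ∀ x y z → (x ⇝ y) ≼ ((y ⇝ z) ⇒ (x ⇝ z))
    mp-⇒ : ∀ x y → x ≼ ((x ⇒ y) ⇝ y)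
    mp-⇝ : ∀ x y → x ≼ ((x ⇝ y) ⇒ y)
    ≼-refl : ∀ x → x ≼ x
    ≼-top : ∀ x → x ≼ 𝟙
    ≼-antisym : ∀ {x y} → x ≼ y → y ≼ x → x ≡ y
    ≼→⇒ : ∀ {x y} → x ≼ y → x ⇒ y ≡ 𝟙
    ⇒→≼ : ∀ {x y} → x ⇒ y ≡ 𝟙 → x ≼ y
    ≼→⇝ : ∀ {x y} → x ≼ y → x ⇝ y ≡ 𝟙
    ⇝→≼ : ∀ {x y} → x ⇝ y ≡ 𝟙 → x ≼ y

record BoundedPseudoBCK : Set₁ where
  field
    pbck : PseudoBCK
  open PseudoBCK pbck public
  field
    𝟘 : A
    𝟘-least : ∀ x → 𝟘 ≼ x

  _⁻ : A → A
  x ⁻ = x ⇒ 𝟘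

  _∼ : A → A
  x ∼ = x ⇝ 𝟘

module _ (Rl : RealNumbers) (B : BoundedPseudoBCK) where
  open RealNumbers Rl
  open BoundedPseudoBCK B

  record IsBosbachState (s : A → ℝ) : Set where
    field
      s-≥0 : ∀ x → 0ℝ ≤ s x
      s-≤1 : ∀ x → s x ≤ 1ℝ
      bosbach-⇒ : ∀ x y → s x + s (x ⇒ y) ≡ s y + s (y ⇒ x)
      bosbach-⇝ : ∀ x y → s x + s (x ⇝ y) ≡ s y + s (y ⇝ x)
      s-𝟘 : s 𝟘 ≡ 0ℝ
      s-𝟙 : s 𝟙 ≡ 1ℝ

  Ker : (A → ℝ) → A → Set
  Ker s a = s a ≡ 1ℝ

  -- Θ_F for a (normal) filter F: a Θ b iff a → b ∈ F and b → a ∈ F.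
  -- The quotient A/F is represented as the setoid (A, Θ_F).
  Θ : (A → Set) → A → A → Set
  Θ F a b = F (a ⇒ b) × F (b ⇒ a)

-- MV-algebras, on a carrier with a setoid equality _≈_
-- (used to represent a quotient without quotient types).

module _ {M : Set} (_≈_ : M → M → Set)
         (_⊕_ : M → M → M) (neg : M → M) (z : M) where

  record IsMVAlgebra : Set where
    field
      isEquivalence : IsEquivalence _≈_
      ⊕-cong : ∀ {x x' y y'} → x ≈ x' → y ≈ y' → (x ⊕ y) ≈ (x' ⊕ y')
      neg-cong : ∀ {x x'} → x ≈ x' → neg x ≈ neg x'
      ⊕-comm : ∀ x y → (x ⊕ y) ≈ (y ⊕ x)
      ⊕-assoc : ∀ x y w → ((x ⊕ y) ⊕ w) ≈ (x ⊕ (y ⊕ w))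
      ⊕-zero : ∀ x → (x ⊕ z) ≈ x
      ⊕-absorb : ∀ x → (x ⊕ neg z) ≈ neg z
      neg-invol : ∀ x → neg (neg x) ≈ x
      łukasiewicz : ∀ x y → (y ⊕ neg (y ⊕ neg x)) ≈ (x ⊕ neg (x ⊕ neg y))

  _≤MV_ : M → M → Set
  x ≤MV y = (neg x ⊕ y) ≈ neg z

  times : ℕ → M → M
  times zero x = z
  times (suc n) x = x ⊕ times n x

  IsArchimedean : Set
  IsArchimedean = ∀ x → (∀ (n : ℕ) → times n x ≤MV neg x) → x ≈ z

  -- MV-state μ : M → [0,1]; it is required to respect _≈_
  -- (i.e. to be well defined on the quotient).
  record IsMVState (Rl : RealNumbers) (μ : M → RealNumbers.ℝ Rl) : Set where
    open RealNumbers Rl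
    field
      μ-cong : ∀ {x y} → x ≈ y → μ x ≡ μ y
      μ-≥0 : ∀ x → 0ℝ ≤ μ x
      μ-≤1 : ∀ x → μ x ≤ 1ℝ
      μ-one : μ (neg z) ≡ 1ℝ
      μ-additive : ∀ a b → neg (neg a ⊕ neg b) ≈ z → μ (a ⊕ b) ≡ μ a + μ b

{-# OPTIONS --safe #-}
module Submission where

open import Defs
open import Data.Nat using (ℕ; suc)
open import Data.Product using (Σ; _×_; _,_; proj₁; proj₂; swap)
open import Data.Sum using (inj₁; inj₂)
open import Function using (_∘_)
open import Algebra.Bundles using (CommutativeSemigroup)
import Algebra.Properties.CommutativeSemigroup as CommutativeSemigroupProperties
open import Relation.Binary.PropositionalEquality
  using (_≡_; refl; sym; trans; cong; cong₂; subst; subst₂; isEquivalence)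

-- Everything but commutativity of the quotient is residuation arithmetic. Think of
-- A/K as the interval [-u, 0] of a lattice-ordered group with a faithful real state s;
-- then x⁻⁻ is the conjugate of x by u. If x is disjoint from x⁻⁻, then so is 2x from
-- (2x)⁻⁻ and s(2x) = 2s(x), so boundedness of s forces x = 0; hence the polars are
-- invariant under conjugation. Consequently, for f = ⁻⁻ and any power of it, f(x) lies
-- between x and f(f(x)), so passing from f to f ∘ f doubles the defect 1 - s(x ⇒ f x),
-- which must therefore vanish: x⁻⁻ = x. Applied to each section [y, 1] in place of A,
-- this gives x ⇒ y = x ⇝ y, which makes ⊕ commutative.

-- Real arithmetic and two consequences of completeness.

module RealProperties (Rl : RealNumbers) where
  open RealNumbers Rl

  +-commutativeSemigroup : CommutativeSemigroup _ _
  +-commutativeSemigroup = record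
    { Carrier = ℝ
    ; _≈_ = _≡_
    ; _∙_ = _+_
    ; isCommutativeSemigroup = record
      { isSemigroup = record
        { isMagma = record { isEquivalence = isEquivalence ; ∙-cong = cong₂ _+_ }
        ; assoc = +-assoc
        }
      ; comm = +-comm
      }
    }

  open CommutativeSemigroupProperties +-commutativeSemigroup public
    using (xy∙z≈xz∙y)

  ≤-reflexive : ∀ {x y} → x ≡ y → x ≤ y
  ≤-reflexive {x} refl = ≤-refl x

  +-monoˡ-≤ : ∀ {x y} z → x ≤ y → z + x ≤ z + y
  +-monoˡ-≤ {x} {y} z p = subst₂ _≤_ (+-comm x z) (+-comm y z) (+-mono-≤ z p)

  x+z-z : ∀ x z → (x + z) + (- z) ≡ x
  x+z-z x z = trans (+-assoc x z (- z))
    (trans (cong (x +_) (+-inverseʳ z)) (+-identityʳ x))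

  +-cancelʳ-≤ : ∀ {x y} z → x + z ≤ y + z → x ≤ y
  +-cancelʳ-≤ {x} {y} z p = subst₂ _≤_ (x+z-z x z) (x+z-z y z) (+-mono-≤ (- z) p)

  +-cancelˡ-≤ : ∀ {x y} z → z + x ≤ z + y → x ≤ y
  +-cancelˡ-≤ {x} {y} z p =
    +-cancelʳ-≤ z (subst₂ _≤_ (+-comm z x) (+-comm z y) p)

  +-cancelʳ-≡ : ∀ {x y} z → x + z ≡ y + z → x ≡ y
  +-cancelʳ-≡ z p =
    ≤-antisym (+-cancelʳ-≤ z (≤-reflexive p)) (+-cancelʳ-≤ z (≤-reflexive (sym p)))

  +-cancelˡ-≡ : ∀ {x y} z → z + x ≡ z + y → x ≡ y
  +-cancelˡ-≡ z p =
    ≤-antisym (+-cancelˡ-≤ z (≤-reflexive p)) (+-cancelˡ-≤ z (≤-reflexive (sym p)))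

  +-identityˡ : ∀ x → 0ℝ + x ≡ x
  +-identityˡ x = trans (+-comm 0ℝ x) (+-identityʳ x)

  -- If u is the greatest lower bound of Q, then u + a - b is a lower bound too.
  bounded-descent : (Q : ℝ → Set) {l q a b : ℝ} → Q q → (∀ r → Q r → l ≤ r) →
    (∀ r → Q r → Σ ℝ λ r′ → Q r′ × r′ + a ≤ r + b) → a ≤ b
  bounded-descent Q {l} {q} {a} {b} Qq l-lower step = +-cancelˡ-≤ u u+a≤u+b
    where
    IsLower : ℝ → Set
    IsLower t = ∀ r → Q r → t ≤ r

    supremum = sup IsLower (l , l-lower) (q , λ t t-lower → t-lower q Qq)
    u = proj₁ supremum

    u-lower : IsLower u
    u-lower r Qr = proj₂ (proj₂ supremum) r (λ t t-lower → t-lower r Qr)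

    shifted-lower : IsLower ((u + a) + (- b))
    shifted-lower r Qr with step r Qr
    ... | r′ , Qr′ , r′+a≤r+b = subst ((u + a) + (- b) ≤_) (x+z-z r b)
      (+-mono-≤ (- b) (≤-trans (+-mono-≤ a (u-lower r′ Qr′)) r′+a≤r+b))

    u+a≤u+b : u + a ≤ u + b
    u+a≤u+b = subst (_≤ u + b)
      (trans (+-assoc (u + a) (- b) b)
        (trans (cong ((u + a) +_) (trans (+-comm (- b) b) (+-inverseʳ b)))
          (+-identityʳ (u + a))))
      (+-mono-≤ b (proj₁ (proj₂ supremum) _ shifted-lower))

  -- In terms of the defect 1 - r, each step at least doubles it. Among the members of `Q` that are
  -- at most `q`, a step therefore descends by at least 1 - q, which the lower bound permits only if
  -- this is not positive.
  bounded-doubling : (Q : ℝ → Set) {l q : ℝ} →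
    (∀ r → Q r → l ≤ r) → (∀ r → Q r → r ≤ 1ℝ) →
    (∀ r → Q r → Σ ℝ λ r′ → Q r′ × r′ + 1ℝ ≤ r + r) →
    Q q → 1ℝ ≤ q
  bounded-doubling Q {l} {q} l-lower ≤1 step Qq =
    bounded-descent (λ r → Q r × r ≤ q) (Qq , ≤-refl q) (λ r → l-lower r ∘ proj₁) step′
    where
    step′ : ∀ r → Q r × r ≤ q → Σ ℝ λ r′ → (Q r′ × r′ ≤ q) × r′ + 1ℝ ≤ r + q
    step′ r (Qr , r≤q) with step r Qr
    ... | r′ , Qr′ , r′+1≤r+r =
      r′ ,
      (Qr′ , ≤-trans (+-cancelʳ-≤ 1ℝ (≤-trans r′+1≤r+r (+-monoˡ-≤ r (≤1 r Qr)))) r≤q) ,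
      ≤-trans r′+1≤r+r (+-monoˡ-≤ r r≤q)

-- A pseudo-BCK algebra with a Bosbach state, ordered by x ≲ y iff x ⇒ y lies in
-- the kernel of the state: this is the quotient by the kernel, as a preorder.
record BosbachAlgebra (Rl : RealNumbers) : Set₁ where
  open RealNumbers Rl
  infixr 5 _⇒_ _⇝_
  infix 4 _≲_
  field
    C : Set
    _⇒_ _⇝_ : C → C → C
    s : C → ℝ

  _≲_ : C → C → Set
  x ≲ y = s (x ⇒ y) ≡ 1ℝ

  field
    s≤1 : ∀ x → s x ≤ 1ℝ
    s-swap : ∀ x y → s (x ⇒ y) ≡ s (x ⇝ y)
    bosbach : ∀ x y → s x + s (x ⇒ y) ≡ s y + s (y ⇒ x)
    ≲-refl : ∀ x → x ≲ x
    ax-⇒ : ∀ x y z → x ⇒ y ≲ (y ⇒ z) ⇝ (x ⇒ z)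
    ax-⇝ : ∀ x y z → x ⇝ y ≲ (y ⇝ z) ⇒ (x ⇝ z)
    mp-⇒ : ∀ x y → x ≲ (x ⇒ y) ⇝ y
    mp-⇝ : ∀ x y → x ≲ (x ⇝ y) ⇒ y
    ≲-weaken-⇒ : ∀ x y → y ≲ x ⇒ y

-- Order and residuation modulo the kernel.

module BosbachProperties {Rl : RealNumbers} (S : BosbachAlgebra Rl) where
  open RealNumbers Rl
  open RealProperties Rl
  open BosbachAlgebra S

  infix 4 _≈_ _⊥_
  infixr 6 _∨_

  s-mp : ∀ {x y} → s x ≡ 1ℝ → x ≲ y → s y ≡ 1ℝ
  s-mp {x} {y} sx x≲y = ≤-antisym (s≤1 y) (+-cancelʳ-≤ 1ℝ
    (≤-trans (≤-reflexive (trans (sym (cong₂ _+_ sx x≲y)) (bosbach x y)))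
      (+-monoˡ-≤ (s y) (s≤1 (y ⇒ x)))))

  ≲⇒⇝ : ∀ {x y} → x ≲ y → s (x ⇝ y) ≡ 1ℝ
  ≲⇒⇝ {x} {y} = trans (sym (s-swap x y))

  ⇝⇒≲ : ∀ {x y} → s (x ⇝ y) ≡ 1ℝ → x ≲ y
  ⇝⇒≲ {x} {y} = trans (s-swap x y)

  ≲-trans : ∀ {x y z} → x ≲ y → y ≲ z → x ≲ z
  ≲-trans {x} {y} {z} p q = s-mp q (⇝⇒≲ (s-mp p (ax-⇒ x y z)))

  s-mono : ∀ {x y} → x ≲ y → s x ≤ s y
  s-mono {x} {y} p = +-cancelʳ-≤ 1ℝ
    (≤-trans (≤-reflexive (trans (cong (s x +_) (sym p)) (bosbach x y)))
      (+-monoˡ-≤ (s y) (s≤1 (y ⇒ x))))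

  -- Faithfulness of the state on the quotient: since `x ⇒ y` has state 1, Bosbach's identity leaves
  -- `s (y ⇒ x)` no room below 1. Most converse inequalities below are obtained from it.
  ≲-reverse : ∀ {x y} → x ≲ y → s y ≤ s x → y ≲ x
  ≲-reverse {x} {y} p q = ≤-antisym (s≤1 (y ⇒ x)) (+-cancelˡ-≤ (s x)
    (≤-trans (≤-reflexive (trans (cong (s x +_) (sym p)) (bosbach x y)))
      (+-mono-≤ (s (y ⇒ x)) q)))

  ⇒-antitone : ∀ {x x′} y → x ≲ x′ → x′ ⇒ y ≲ x ⇒ y
  ⇒-antitone {x} {x′} y p = ⇝⇒≲ (s-mp p (ax-⇒ x x′ y))

  ⇝-antitone : ∀ {x x′} y → x ≲ x′ → x′ ⇝ y ≲ x ⇝ y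
  ⇝-antitone {x} {x′} y p = s-mp (≲⇒⇝ p) (ax-⇝ x x′ y)

  -- Both sides stand for x ⊙ y ≤ z, with a product that the signature does not contain.
  galois-⇒ : ∀ {x y z} → x ≲ y ⇒ z → y ≲ x ⇝ z
  galois-⇒ {x} {y} {z} p = ≲-trans (mp-⇒ y z) (⇝-antitone z p)

  galois-⇝ : ∀ {x y z} → x ≲ y ⇝ z → y ≲ x ⇒ z
  galois-⇝ {x} {y} {z} p = ≲-trans (mp-⇝ y z) (⇒-antitone z p)

  compose-⇒ : ∀ x y z → y ⇒ z ≲ (x ⇒ y) ⇒ (x ⇒ z)
  compose-⇒ x y z = galois-⇝ (ax-⇒ x y z)

  compose-⇝ : ∀ x y z → y ⇝ z ≲ (x ⇝ y) ⇝ (x ⇝ z)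
  compose-⇝ x y z = galois-⇒ (ax-⇝ x y z)

  ⇒-monotone : ∀ x {y y′} → y ≲ y′ → x ⇒ y ≲ x ⇒ y′
  ⇒-monotone x {y} {y′} p = s-mp p (compose-⇒ x y y′)

  ⇝-monotone : ∀ x {y y′} → y ≲ y′ → x ⇝ y ≲ x ⇝ y′
  ⇝-monotone x {y} {y′} p = ⇝⇒≲ (s-mp (≲⇒⇝ p) (compose-⇝ x y y′))

  exchange-⇒⇝ : ∀ x y z → x ⇒ (y ⇝ z) ≲ y ⇝ (x ⇒ z)
  exchange-⇒⇝ x y z = galois-⇒ (≲-trans (mp-⇝ y z) (compose-⇒ x (y ⇝ z) z))

  exchange-⇝⇒ : ∀ x y z → x ⇝ (y ⇒ z) ≲ y ⇒ (x ⇝ z)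
  exchange-⇝⇒ x y z = galois-⇝ (≲-trans (mp-⇒ y z) (compose-⇝ x (y ⇒ z) z))

  ≲-top : ∀ x {y} → s y ≡ 1ℝ → x ≲ y
  ≲-top x {y} p = s-mp p (≲-weaken-⇒ x y)

  ≲-weaken-⇝ : ∀ x y → y ≲ x ⇝ y
  ≲-weaken-⇝ x y = galois-⇒ (≲-top x (≲-refl y))

  _≈_ : C → C → Set
  x ≈ y = x ≲ y × y ≲ x

  ≈-refl : ∀ x → x ≈ x
  ≈-refl x = ≲-refl x , ≲-refl x

  ≈-sym : ∀ {x y} → x ≈ y → y ≈ x
  ≈-sym = swap

  ≈-trans : ∀ {x y z} → x ≈ y → y ≈ z → x ≈ z
  ≈-trans (p , p′) (q , q′) = ≲-trans p q , ≲-trans q′ p′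

  ≈⇒s≡ : ∀ {x y} → x ≈ y → s x ≡ s y
  ≈⇒s≡ (p , q) = ≤-antisym (s-mono p) (s-mono q)

  ⇒-cong : ∀ {x x′ y y′} → x ≈ x′ → y ≈ y′ → x ⇒ y ≈ x′ ⇒ y′
  ⇒-cong {x} {x′} {y} {y′} (p , p′) (q , q′) =
    ≲-trans (⇒-antitone y p′) (⇒-monotone x′ q) ,
    ≲-trans (⇒-antitone y′ p) (⇒-monotone x q′)

  ⇝-cong : ∀ {x x′ y y′} → x ≈ x′ → y ≈ y′ → x ⇝ y ≈ x′ ⇝ y′
  ⇝-cong {x} {x′} {y} {y′} (p , p′) (q , q′) =
    ≲-trans (⇝-antitone y p′) (⇝-monotone x′ q) ,
    ≲-trans (⇝-antitone y′ p) (⇝-monotone x q′)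

  exchange : ∀ x y z → x ⇒ (y ⇝ z) ≈ y ⇝ (x ⇒ z)
  exchange x y z = exchange-⇒⇝ x y z , exchange-⇝⇒ y x z

  -- Joins and disjointness.

  _∨_ : C → C → C
  x ∨ y = (x ⇒ y) ⇝ y

  x≲x∨y : ∀ x y → x ≲ x ∨ y
  x≲x∨y = mp-⇒

  y≲x∨y : ∀ x y → y ≲ x ∨ y
  y≲x∨y x y = ≲-weaken-⇝ (x ⇒ y) y

  s-residual : ∀ {x y} → y ≲ x → s x + s (x ⇒ y) ≡ s y + 1ℝ
  s-residual {x} {y} p = trans (bosbach x y) (cong (s y +_) p)

  s-∨ : ∀ x y → s (x ∨ y) + s (x ⇒ y) ≡ s y + 1ℝ
  s-∨ x y = trans (+-comm _ _)
    (trans (cong (s (x ⇒ y) +_) (sym (s-swap (x ⇒ y) y)))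
      (s-residual (≲-weaken-⇒ x y)))

  -- `x ∨ y` lies above `x`, and either state adds up with `s (x ⇒ y)` to `s y + 1`, so faithfulness
  -- applies. This is what makes `∨` a least upper bound.
  ∨-absorb : ∀ {x y} → y ≲ x → x ∨ y ≲ x
  ∨-absorb {x} {y} p = ≲-reverse (x≲x∨y x y)
    (≤-reflexive (+-cancelʳ-≡ (s (x ⇒ y)) (trans (s-∨ x y) (sym (s-residual p)))))

  ∨-absorb′ : ∀ {x y} → y ≲ x → (x ⇝ y) ⇒ y ≲ x
  ∨-absorb′ {x} {y} p = ≲-reverse (mp-⇝ x y)
    (≤-reflexive (+-cancelʳ-≡ (s (x ⇝ y))
      (trans (+-comm _ _) (trans (s-residual (≲-weaken-⇝ x y))
        (sym (trans (cong (s x +_) (sym (s-swap x y))) (s-residual p)))))))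

  ∨-lub : ∀ {x y j} → x ≲ j → y ≲ j → x ∨ y ≲ j
  ∨-lub {x} {y} {j} p q = ≲-trans (⇝-antitone y (⇒-antitone y p)) (∨-absorb q)

  ∨-comm : ∀ x y → x ∨ y ≈ y ∨ x
  ∨-comm x y = ∨-lub (y≲x∨y y x) (x≲x∨y y x) , ∨-lub (y≲x∨y x y) (x≲x∨y x y)

  -- Equivalent to x ∨ y ≈ 1, that is, to disjointness in the negative cone.
  _⊥_ : C → C → Set
  x ⊥ y = x ⇒ y ≲ y

  -- Disjointness gives `s (x ⇒ y)` the value `s y`; Bosbach's identity then gives `s (y ⇒ x)` the
  -- value `s x`.
  ⊥-sym : ∀ {x y} → x ⊥ y → y ⊥ x
  ⊥-sym {x} {y} p = ≲-reverse (≲-weaken-⇒ y x)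
    (≤-reflexive (+-cancelˡ-≡ (s y)
      (trans (sym (bosbach x y))
        (trans (cong (s x +_) (≈⇒s≡ (p , ≲-weaken-⇒ x y))) (+-comm (s x) (s y))))))

  ⊥-⇝ : ∀ {x y} → x ⊥ y → x ⇝ y ≲ y
  ⊥-⇝ {x} {y} p = ≲-reverse (≲-weaken-⇝ x y)
    (≤-trans (≤-reflexive (sym (s-swap x y))) (s-mono p))

  ⊥-monoˡ : ∀ {x x′ y} → x ≲ x′ → x ⊥ y → x′ ⊥ y
  ⊥-monoˡ {y = y} p x⊥y = ≲-trans (⇒-antitone y p) x⊥y

  ⊥-mono : ∀ {x x′ y y′} → x ≲ x′ → y ≲ y′ → x ⊥ y → x′ ⊥ y′
  ⊥-mono p q = ⊥-sym ∘ ⊥-monoˡ q ∘ ⊥-sym ∘ ⊥-monoˡ p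

  ⊥⇒top : ∀ {x y j} → x ⊥ y → x ≲ j → y ≲ j → s j ≡ 1ℝ
  ⊥⇒top {j = j} x⊥y p q = s-mp (≲-refl j) (⊥-mono p q x⊥y)

  ∨-top⇒⊥ : ∀ {x y} → s (x ∨ y) ≡ 1ℝ → x ⊥ y
  ∨-top⇒⊥ = ⇝⇒≲

  -- The hypotheses say that y lies between x and t, so that x ⇒ t is the
  -- product of x ⇒ y and y ⇒ t.
  s-⇒-between : ∀ {x y t} → (x ⇒ y) ⊥ (t ⇒ y) → (y ⇒ x) ⊥ (y ⇒ t) →
    s (x ⇒ t) + 1ℝ ≤ s (x ⇒ y) + s (y ⇒ t)
  s-⇒-between {x} {y} {t} below above = ≤-trans (+-mono-≤ 1ℝ (s-mono x⇒t≲p⇒t)) bound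
    where
    p = x ∨ y

    -- `y ⇒ (x ∨ t)` is a common upper bound of the disjoint elements `y ⇒ x` and `y ⇒ t`.
    y≲x∨t : y ≲ x ∨ t
    y≲x∨t = ⊥⇒top above (⇒-monotone y (x≲x∨y x t)) (⇒-monotone y (y≲x∨y x t))

    x⇒t≲p⇒t : x ⇒ t ≲ p ⇒ t
    x⇒t≲p⇒t = galois-⇝ (∨-lub (x≲x∨y x t) y≲x∨t)

    t⇒p≲t⇒y : t ⇒ p ≲ t ⇒ y
    t⇒p≲t⇒y = ≲-trans (exchange-⇒⇝ t (x ⇒ y) y) (⊥-⇝ below)

    sp+sp⇒t : s p + s (p ⇒ t) ≤ s y + s (y ⇒ t)
    sp+sp⇒t = ≤-trans (≤-reflexive (bosbach p t))
      (≤-trans (+-monoˡ-≤ (s t) (s-mono t⇒p≲t⇒y)) (≤-reflexive (sym (bosbach y t))))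

    bound : s (p ⇒ t) + 1ℝ ≤ s (x ⇒ y) + s (y ⇒ t)
    bound = +-cancelˡ-≤ (s y) (subst₂ _≤_ left right (+-mono-≤ (s (x ⇒ y)) sp+sp⇒t))
      where
      left : (s p + s (p ⇒ t)) + s (x ⇒ y) ≡ s y + (s (p ⇒ t) + 1ℝ)
      left = trans (xy∙z≈xz∙y _ _ _) (trans (cong (_+ s (p ⇒ t)) (s-∨ x y))
        (trans (+-assoc _ _ _) (cong (s y +_) (+-comm _ _))))
      right : (s y + s (y ⇒ t)) + s (x ⇒ y) ≡ s y + (s (x ⇒ y) + s (y ⇒ t))
      right = trans (+-assoc _ _ _) (cong (s y +_) (+-comm _ _))

-- Algebras with a least element: double negation is the identity.

module Bounded {Rl : RealNumbers} (S : BosbachAlgebra Rl)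
  (𝟘 : BosbachAlgebra.C S) (𝟘-least : ∀ x → BosbachAlgebra._≲_ S 𝟘 x) where
  open RealNumbers Rl
  open RealProperties Rl
  open BosbachAlgebra S
  open BosbachProperties S

  infix 8 _⁻ _∼

  _⁻ _∼ : C → C
  x ⁻ = x ⇒ 𝟘
  x ∼ = x ⇝ 𝟘

  ⁻-antitone : ∀ {x y} → x ≲ y → y ⁻ ≲ x ⁻
  ⁻-antitone = ⇒-antitone 𝟘

  ∼-antitone : ∀ {x y} → x ≲ y → y ∼ ≲ x ∼
  ∼-antitone = ⇝-antitone 𝟘

  ⁻∼ : ∀ x → x ⁻ ∼ ≈ x
  ⁻∼ x = ∨-absorb (𝟘-least x) , mp-⇒ x 𝟘

  ∼⁻ : ∀ x → x ∼ ⁻ ≈ x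
  ∼⁻ x = ∨-absorb′ (𝟘-least x) , mp-⇝ x 𝟘

  s-⁻ : ∀ x → s x + s (x ⁻) ≡ s 𝟘 + 1ℝ
  s-⁻ x = s-residual (𝟘-least x)

  s-∼ : ∀ x → s x + s (x ∼) ≡ s 𝟘 + 1ℝ
  s-∼ x = trans (cong (s x +_) (sym (s-swap x 𝟘))) (s-⁻ x)

  contrapositive-⇒ : ∀ x y → x ⇒ y ≈ y ⁻ ⇝ x ⁻
  contrapositive-⇒ x y =
    ≈-trans (⇒-cong (≈-refl x) (≈-sym (⁻∼ y))) (exchange x (y ⁻) 𝟘)

  contrapositive-⇝ : ∀ x y → x ⇝ y ≈ y ∼ ⇒ x ∼
  contrapositive-⇝ x y =
    ≈-trans (⇝-cong (≈-refl x) (≈-sym (∼⁻ y))) (≈-sym (exchange (y ∼) x 𝟘))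

  -- Prelinearity. The join `q` of the two implications is disjoint from `j ⁻`, because `q ⇒ j ⁻`
  -- lies below both `x ⁻` and `y ⁻`. As `j ⁻` also lies below `q`, the latter is top.
  ⇒-⊥-⇒ : ∀ x y → (x ⇒ y) ⊥ (y ⇒ x)
  ⇒-⊥-⇒ x y = ∨-top⇒⊥ (⊥⇒top q⊥j⁻ (≲-refl q) j⁻≲q)
    where
    j = x ∨ y
    q = (x ⇒ y) ∨ (y ⇒ x)

    -- q ⇒ j⁻ is the negation of the product q ⊙ j, which lies above (a ⇒ b) ⊙ j ≈ b.
    q⇒j⁻≲ : ∀ {a b} → a ≲ j → b ≲ j → a ⇒ b ≲ q → q ⇒ j ⁻ ≲ b ⁻
    q⇒j⁻≲ {a} {b} a≲j b≲j a⇒b≲q = ≲-trans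
      (⇒-antitone (j ⁻)
        (≲-trans (proj₂ (contrapositive-⇒ j b)) (≲-trans (⇒-antitone b a≲j) a⇒b≲q)))
      (∨-absorb′ (⁻-antitone b≲j))

    q⊥j⁻ : q ⊥ j ⁻
    q⊥j⁻ = galois-⇝ (∨-lub
      (galois-⇒ (q⇒j⁻≲ (y≲x∨y x y) (x≲x∨y x y) (y≲x∨y _ _)))
      (galois-⇒ (q⇒j⁻≲ (x≲x∨y x y) (y≲x∨y x y) (x≲x∨y _ _))))

    j⁻≲q : j ⁻ ≲ q
    j⁻≲q = ≲-trans (⁻-antitone (x≲x∨y x y))
      (≲-trans (⇒-monotone x (𝟘-least y)) (x≲x∨y _ _))

  -- Compares lower bounds: `r` is below either side exactly when `r ∼ ∼ ≲ y ⇝ x`. With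
  -- contraposition this makes `⁻⁻` respect `⇒`.
  ⁻⇒⁻ : ∀ x y → x ⁻ ⇒ y ⁻ ≈ (y ⇝ x) ⁻ ⁻
  ⁻⇒⁻ x y = to (≲-refl _) , from (≲-refl _)
    where
    to : ∀ {r} → r ≲ x ⁻ ⇒ y ⁻ → r ≲ (y ⇝ x) ⁻ ⁻
    to {r} p = ≲-trans (proj₂ (∼⁻ r)) (⁻-antitone (≲-trans (⁻-antitone r∼∼≲y⇝x)
      (proj₁ (∼⁻ (r ∼)))))
      where
      r∼∼≲y⇝x : r ∼ ∼ ≲ y ⇝ x
      r∼∼≲y⇝x = galois-⇒ (≲-trans
        (galois-⇒ (≲-trans (galois-⇒ p) (exchange-⇝⇒ r y 𝟘)))
        (≲-trans (⇝-monotone (x ⁻) (proj₂ (∼⁻ (r ∼)))) (proj₂ (contrapositive-⇒ (r ∼ ∼) x))))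

    from : ∀ {r} → r ≲ (y ⇝ x) ⁻ ⁻ → r ≲ x ⁻ ⇒ y ⁻
    from {r} p = galois-⇝ (≲-trans (galois-⇝ y≲x⁻⇝r∼) (exchange-⇒⇝ y r 𝟘))
      where
      r∼∼≲y⇝x : r ∼ ∼ ≲ y ⇝ x
      r∼∼≲y⇝x = ≲-trans
        (∼-antitone (≲-trans (proj₂ (⁻∼ ((y ⇝ x) ⁻))) (∼-antitone p)))
        (proj₁ (⁻∼ (y ⇝ x)))
      y≲x⁻⇝r∼ : y ≲ x ⁻ ⇝ r ∼
      y≲x⁻⇝r∼ = ≲-trans (galois-⇝ r∼∼≲y⇝x)
        (≲-trans (proj₁ (contrapositive-⇒ (r ∼ ∼) x)) (⇝-monotone (x ⁻) (proj₁ (∼⁻ (r ∼)))))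

  ⁻⁻-⇒ : ∀ x y → (x ⇒ y) ⁻ ⁻ ≈ x ⁻ ⁻ ⇒ y ⁻ ⁻
  ⁻⁻-⇒ x y = ≈-sym (≈-trans (⁻⇒⁻ (x ⁻) (y ⁻)) (⇒-cong (⇒-cong
    (≈-sym (contrapositive-⇒ x y)) (≈-refl 𝟘)) (≈-refl 𝟘)))

  s-⁻⁻ : ∀ x → s (x ⁻ ⁻) ≡ s x
  s-⁻⁻ x = +-cancelˡ-≡ (s (x ⁻)) (trans (s-⁻ (x ⁻)) (trans (sym (s-⁻ x)) (+-comm _ _)))

  -- The product x ⊙ x.
  square : C → C
  square x = (x ⇒ x ⁻) ∼

  -- Currying bounds `square x ⇒ y` by `x ⇒ (x ⇒ y)`, and disjointness removes the two antecedents
  -- in turn.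
  ⊥-square : ∀ {x y} → x ⊥ y → square x ⊥ y
  ⊥-square {x} {y} x⊥y = ≲-trans
    (⇒-monotone (square x) (proj₂ (⁻∼ y)))
    (≲-trans (proj₂ (contrapositive-⇝ (y ⁻) (x ⇒ x ⁻)))
    (≲-trans (exchange-⇝⇒ (y ⁻) x (x ⁻))
    (≲-trans (⇒-monotone x (≲-trans (proj₂ (contrapositive-⇒ x y)) x⊥y)) x⊥y)))

  square-⁻⁻ : ∀ x → square (x ⁻ ⁻) ≲ square x ⁻ ⁻
  square-⁻⁻ x = ≲-trans (∼-antitone (proj₁ (⁻⁻-⇒ x (x ⁻))))
    (≲-trans (proj₁ (⁻∼ _)) (⁻-antitone (proj₁ (∼⁻ _))))

  -- The hypothesis says that the product is not truncated at `𝟘`, so squaring doubles the defect 1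
  -- - s x exactly.
  s-square : ∀ {x} → x ⁻ ≲ x → s (square x) + 1ℝ ≡ s x + s x
  s-square {x} p = +-cancelʳ-≡ (s (x ⁻)) (trans (trans (xy∙z≈xz∙y _ _ _) (trans
      (+-assoc _ _ _) (trans (cong (s (square x) +_) (sym (s-residual p)))
      (trans (sym (+-assoc _ _ _)) (trans (xy∙z≈xz∙y _ _ _)
      (cong (_+ s x) (trans (+-comm _ _) (trans (s-∼ (x ⇒ x ⁻)) (sym (s-⁻ x))))))))))
    (xy∙z≈xz∙y _ _ _))

  ⊥-⁻⁻⇒top : ∀ {x} → x ⊥ x ⁻ ⁻ → s x ≡ 1ℝ
  ⊥-⁻⁻⇒top {x} x⊥x⁻⁻ = ≤-antisym (s≤1 x) (bounded-doubling Q
    (λ { _ (y , _ , refl) → s-mono (𝟘-least y) })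
    (λ { _ (y , _ , refl) → s≤1 y })
    (λ { _ (y , y⊥ , refl) → _ ,
      (square y , ⊥-mono (≲-refl _) (square-⁻⁻ y)
        (⊥-square (⊥-sym (⊥-square (⊥-sym y⊥)))) , refl) ,
      ≤-reflexive (s-square (y⁻≲y y⊥)) })
    (x , x⊥x⁻⁻ , refl))
    where
    Q : ℝ → Set
    Q r = Σ C λ y → (y ⊥ y ⁻ ⁻) × s y ≡ r

    -- The hypothesis of `s-square`: `y ⁻` is `y ⁻ ⁻ ⇝ 𝟘`, hence below `y ⁻ ⁻ ⇝ y`, which
    -- disjointness puts below `y`.
    y⁻≲y : ∀ {y} → y ⊥ y ⁻ ⁻ → y ⁻ ≲ y
    y⁻≲y {y} y⊥ = ≲-trans (proj₂ (⁻∼ (y ⁻)))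
      (≲-trans (⇝-monotone (y ⁻ ⁻) (𝟘-least y)) (⊥-⇝ (⊥-sym y⊥)))

  ⊥-⁻⁻ : ∀ {x y} → x ⊥ y → x ⁻ ⁻ ⊥ y
  ⊥-⁻⁻ {x} {y} x⊥y = ∨-top⇒⊥ (trans st≡su (⊥-⁻⁻⇒top u⊥u⁻⁻))
    where
    t = x ⁻ ⁻ ∨ y
    -- The preimage of `t` under `⁻⁻`. It has the same state as `t`, and `x ≲ u` and `y ≲ u ⁻ ⁻`, so
    -- `u` is disjoint from its double negation.
    u = t ∼ ∼

    x≲u : x ≲ u
    x≲u = ≲-trans (proj₂ (⁻∼ x))
      (∼-antitone (≲-trans (∼-antitone (x≲x∨y (x ⁻ ⁻) y)) (proj₁ (⁻∼ (x ⁻)))))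

    t≲u⁻⁻ : t ≲ u ⁻ ⁻
    t≲u⁻⁻ = ≲-trans (proj₂ (∼⁻ t)) (⁻-antitone (proj₁ (∼⁻ (t ∼))))

    u⊥u⁻⁻ : u ⊥ u ⁻ ⁻
    u⊥u⁻⁻ = ⊥-mono x≲u (≲-trans (y≲x∨y (x ⁻ ⁻) y) t≲u⁻⁻) x⊥y

    st≡su : s t ≡ s u
    st≡su = +-cancelˡ-≡ (s (t ∼))
      (trans (+-comm _ _) (trans (s-∼ t) (sym (s-∼ (t ∼)))))

  -- Consequences of f = ⁻⁻ being an automorphism, in a form visibly inherited by f ∘ f.
  record IsStable (f : C → C) : Set where
    field
      s-⇒ : ∀ x y → s (f x ⇒ f y) ≡ s (x ⇒ y)
      ⊥-⇒ : ∀ {x y z} → (x ⇒ y) ⊥ z → (f x ⇒ f y) ⊥ z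
  open IsStable

  ⁻⁻-stable : IsStable (λ x → x ⁻ ⁻)
  ⁻⁻-stable .s-⇒ x y = trans (sym (≈⇒s≡ (⁻⁻-⇒ x y))) (s-⁻⁻ (x ⇒ y))
  ⁻⁻-stable .⊥-⇒ {x} {y} p = ⊥-monoˡ (proj₁ (⁻⁻-⇒ x y)) (⊥-⁻⁻ p)

  ∘-stable : ∀ {f} → IsStable f → IsStable (f ∘ f)
  ∘-stable {f} st .s-⇒ x y = trans (st .s-⇒ (f x) (f y)) (st .s-⇒ x y)
  ∘-stable st .⊥-⇒ p = st .⊥-⇒ (st .⊥-⇒ p)

  -- Prelinearity makes `x ⇒ f x` and `f x ⇒ x` disjoint. Applying `f` to either one alone keeps
  -- them so, which places `f x` between `x` and `f (f x)`.
  stable-step : ∀ {f} → IsStable f → ∀ x →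
    s (x ⇒ f (f x)) + 1ℝ ≤ s (x ⇒ f x) + s (x ⇒ f x)
  stable-step {f} st x = subst (λ r → s (x ⇒ f (f x)) + 1ℝ ≤ s (x ⇒ f x) + r)
    (st .s-⇒ x (f x))
    (s-⇒-between
      (⊥-sym (st .⊥-⇒ (⇒-⊥-⇒ (f x) x)))
      (⊥-sym (st .⊥-⇒ (⇒-⊥-⇒ x (f x)))))

  x≲x⁻⁻ : ∀ x → x ≲ x ⁻ ⁻
  x≲x⁻⁻ x = ≤-antisym (s≤1 _) (bounded-doubling Q
    (λ { _ (f , _ , refl) → s-mono (𝟘-least (x ⇒ f x)) })
    (λ { _ (f , _ , refl) → s≤1 _ })
    (λ { _ (f , st , refl) → _ , (f ∘ f , ∘-stable st , refl) , stable-step st x })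
    (_ , ⁻⁻-stable , refl))
    where
    -- Ranging over all stable maps avoids indexing the powers of `⁻⁻`.
    Q : ℝ → Set
    Q r = Σ (C → C) λ f → IsStable f × s (x ⇒ f x) ≡ r

  ⁻⁻ : ∀ x → x ⁻ ⁻ ≈ x
  ⁻⁻ x = ≲-reverse (x≲x⁻⁻ x) (≤-reflexive (s-⁻⁻ x)) , x≲x⁻⁻ x

  ⁻≲∼ : ∀ x → x ⁻ ≲ x ∼
  ⁻≲∼ x = ≲-trans (proj₂ (⁻∼ (x ⁻))) (∼-antitone (x≲x⁻⁻ x))

-- The two implications coincide modulo the kernel.

module Commutativity {Rl : RealNumbers} (S : BosbachAlgebra Rl) where
  open RealNumbers Rl
  open RealProperties Rl
  open BosbachAlgebra S
  open BosbachProperties S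

  -- The interval from `c` to the top. The state need not vanish at `c`, which is why `Bounded`
  -- leaves `s 𝟘` arbitrary.
  section : C → BosbachAlgebra Rl
  section c = record
    { C = Σ C (c ≲_)
    ; _⇒_ = λ (x , _) (y , c≲y) → x ⇒ y , ≲-trans c≲y (≲-weaken-⇒ x y)
    ; _⇝_ = λ (x , _) (y , c≲y) → x ⇝ y , ≲-trans c≲y (≲-weaken-⇝ x y)
    ; s = s ∘ proj₁
    ; s≤1 = λ _ → s≤1 _
    ; s-swap = λ _ _ → s-swap _ _
    ; bosbach = λ _ _ → bosbach _ _
    ; ≲-refl = λ _ → ≲-refl _
    ; ax-⇒ = λ _ _ _ → ax-⇒ _ _ _
    ; ax-⇝ = λ _ _ _ → ax-⇝ _ _ _
    ; mp-⇒ = λ _ _ → mp-⇒ _ _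
    ; mp-⇝ = λ _ _ → mp-⇝ _ _
    ; ≲-weaken-⇒ = λ _ _ → ≲-weaken-⇒ _ _
    }

  -- In the section at `y`, implication into `y` is negation. Since `x` may lie outside that
  -- section, `x ∨ y` replaces it, which does not shrink `x ⇒ y`.
  ⇒≈⇝ : ∀ x y → x ⇒ y ≈ x ⇝ y
  ⇒≈⇝ x y = p , ≲-reverse p (≤-reflexive (sym (s-swap x y)))
    where
    p : x ⇒ y ≲ x ⇝ y
    p = ≲-trans (galois-⇝ (≲-refl (x ∨ y)))
      (≲-trans (Bounded.⁻≲∼ (section y) (y , ≲-refl y) proj₂ (x ∨ y , y≲x∨y x y))
        (⇝-antitone y (x≲x∨y x y)))

-- The MV-algebra structure, its archimedean property and the state.

module MV {Rl : RealNumbers} (S : BosbachAlgebra Rl)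
  (𝟘 : BosbachAlgebra.C S) (𝟘-least : ∀ x → BosbachAlgebra._≲_ S 𝟘 x)
  (s𝟘≡0 : BosbachAlgebra.s S 𝟘 ≡ RealNumbers.0ℝ Rl) where
  open RealNumbers Rl
  open RealProperties Rl
  open BosbachAlgebra S
  open BosbachProperties S
  open Bounded S 𝟘 𝟘-least
  open Commutativity S using (⇒≈⇝)

  infixr 6 _⊕_

  _⊕_ : C → C → C
  x ⊕ y = x ∼ ⇒ y

  ⁻-cong : ∀ {x y} → x ≈ y → x ⁻ ≈ y ⁻
  ⁻-cong p = ⇒-cong p (≈-refl 𝟘)

  ⊕-cong : ∀ {x x′ y y′} → x ≈ x′ → y ≈ y′ → x ⊕ y ≈ x′ ⊕ y′
  ⊕-cong p = ⇒-cong (⇝-cong p (≈-refl 𝟘))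

  ⊕-comm : ∀ x y → x ⊕ y ≈ y ⊕ x
  ⊕-comm x y = ≈-trans (contrapositive-⇒ (x ∼) y)
    (≈-trans (⇝-cong (⇒≈⇝ y 𝟘) (∼⁻ x)) (≈-sym (⇒≈⇝ (y ∼) x)))

  ⊕-left-comm : ∀ x y z → x ⊕ (y ⊕ z) ≈ y ⊕ (x ⊕ z)
  ⊕-left-comm x y z = ≈-trans (⇒-cong (≈-refl (x ∼)) (⇒≈⇝ (y ∼) z))
    (≈-trans (exchange (x ∼) (y ∼) z) (≈-sym (⇒≈⇝ (y ∼) (x ⊕ z))))

  ⊕-assoc : ∀ x y z → (x ⊕ y) ⊕ z ≈ x ⊕ (y ⊕ z)
  ⊕-assoc x y z = ≈-trans (⊕-comm (x ⊕ y) z)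
    (≈-trans (⊕-left-comm z x y) (⊕-cong (≈-refl x) (⊕-comm z y)))

  ⁻⊕ : ∀ x y → x ⁻ ⊕ y ≈ x ⇒ y
  ⁻⊕ x y = ⇒-cong (⁻∼ x) (≈-refl y)

  -- Reduces the Łukasiewicz identity to commutativity of `∨`.
  ⊕-join : ∀ x y → y ⊕ (y ⊕ x ⁻) ⁻ ≈ x ∨ y
  ⊕-join x y = ≈-trans (⊕-comm y _) (≈-trans (⁻⊕ (y ⊕ x ⁻) y)
    (≈-trans (⇒-cong (≈-trans (⊕-comm y (x ⁻)) (⁻⊕ x y)) (≈-refl y)) (⇒≈⇝ (x ⇒ y) y)))

  top-≈ : ∀ {x y} → s x ≡ 1ℝ → s y ≡ 1ℝ → x ≈ y
  top-≈ p q = ≲-top _ q , ≲-top _ p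

  isMVAlgebra : IsMVAlgebra _≈_ _⊕_ _⁻ 𝟘
  isMVAlgebra = record
    { isEquivalence = record { refl = ≈-refl _ ; sym = ≈-sym ; trans = ≈-trans }
    ; ⊕-cong = ⊕-cong
    ; neg-cong = ⁻-cong
    ; ⊕-comm = ⊕-comm
    ; ⊕-assoc = ⊕-assoc
    ; ⊕-zero = ∼⁻
    ; ⊕-absorb = λ x → top-≈ (≲-top (x ∼) (≲-refl 𝟘)) (≲-refl 𝟘)
    ; neg-invol = ⁻⁻
    ; łukasiewicz = λ x y →
        ≈-trans (⊕-join x y) (≈-trans (∨-comm x y) (≈-sym (⊕-join y x)))
    }

  -- As `y ≲ x ∼`, Bosbach's identity for `x ∼` and `y` gives `s (x ∼) + s (x ⊕ y)` the value
  -- `s y + 1`, and this 1 is `s (x ∼) + s x`.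
  s-⊕ : ∀ {x y} → x ≲ y ⁻ → s (x ⊕ y) ≡ s x + s y
  s-⊕ {x} {y} p = +-cancelˡ-≡ (s (x ∼)) (trans (bosbach (x ∼) y)
    (trans (cong (s y +_) (galois-⇒ p)) (trans (+-comm _ _)
      (trans (cong (_+ s y) (sym sx∼+sx)) (+-assoc _ _ _)))))
    where
    sx∼+sx : s (x ∼) + s x ≡ 1ℝ
    sx∼+sx = trans (+-comm _ _)
      (trans (s-∼ x) (trans (cong (_+ 1ℝ) s𝟘≡0) (+-identityˡ 1ℝ)))

  ≤MV⇒≲ : ∀ {x y} → x ⁻ ⊕ y ≈ 𝟘 ⁻ → x ≲ y
  ≤MV⇒≲ {x} {y} p = trans (sym (≈⇒s≡ (⁻⊕ x y))) (trans (≈⇒s≡ p) (≲-refl 𝟘))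

  -- The hypothesis makes the state additive along the multiples of `x`. So the states of their
  -- negations drop by `s x` at each step while staying above `s 𝟘`, which forces `s x` to be at
  -- most 0.
  isArchimedean : IsArchimedean _≈_ _⊕_ _⁻ 𝟘
  isArchimedean x nx≤x⁻ = ≲-reverse (𝟘-least x) sx≤s𝟘 , 𝟘-least x
    where
    multiple : ℕ → C
    multiple n = times _≈_ _⊕_ _⁻ 𝟘 n x

    s-suc : ∀ n → s (multiple (suc n)) ≡ s x + s (multiple n)
    s-suc n = s-⊕ (≲-trans (galois-⇒ (≤MV⇒≲ (nx≤x⁻ n))) (proj₂ (⇒≈⇝ (multiple n) 𝟘)))

    Q : ℝ → Set
    Q r = Σ ℕ λ n → s (multiple n ⁻) ≡ r

    step : ∀ n → s (multiple (suc n) ⁻) + s x ≡ s (multiple n ⁻) + 0ℝ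
    step n = trans (+-cancelˡ-≡ (s (multiple n)) (trans lhs (sym (s-⁻ (multiple n)))))
      (sym (+-identityʳ _))
      where
      lhs : s (multiple n) + (s (multiple (suc n) ⁻) + s x) ≡ s 𝟘 + 1ℝ
      lhs = trans (+-comm _ _) (trans (+-assoc _ _ _)
        (trans (cong (s (multiple (suc n) ⁻) +_) (sym (s-suc n)))
          (trans (+-comm _ _) (s-⁻ (multiple (suc n))))))

    sx≤s𝟘 : s x ≤ s 𝟘
    sx≤s𝟘 = subst (s x ≤_) (sym s𝟘≡0) (bounded-descent Q (0 , refl)
      (λ { _ (n , refl) → s-mono (𝟘-least (multiple n ⁻)) })
      (λ { _ (n , refl) → _ , (suc n , refl) , ≤-reflexive (step n) }))

  isMVState : IsMVState _≈_ _⊕_ _⁻ 𝟘 Rl s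
  isMVState = record
    { μ-cong = ≈⇒s≡
    ; μ-≥0 = λ x → subst (_≤ s x) s𝟘≡0 (s-mono (𝟘-least x))
    ; μ-≤1 = s≤1
    ; μ-one = ≲-refl 𝟘
    -- Negating the hypothesis turns it into the MV-order statement that `x` is below `y ⁻`.
    ; μ-additive = λ x y p → s-⊕ (≤MV⇒≲
        (≈-trans (≈-sym (⁻⁻ (x ⁻ ⊕ y ⁻))) (⁻-cong p)))
    }

-- From a bounded pseudo-BCK algebra with a Bosbach state to a `BosbachAlgebra`.

module PseudoBCKProperties (B : BoundedPseudoBCK) where
  open BoundedPseudoBCK B

  𝟙-greatest : ∀ {x} → 𝟙 ≼ x → x ≡ 𝟙
  𝟙-greatest = ≼-antisym (≼-top _)

  ≼-trans : ∀ {x y z} → x ≼ y → y ≼ z → x ≼ z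
  ≼-trans {x} {y} {z} p q = ⇒→≼ (𝟙-greatest (⇝→≼ (𝟙-greatest
    (subst₂ (λ a b → a ≼ b ⇝ (x ⇒ z)) (≼→⇒ p) (≼→⇒ q) (ax-⇒ x y z)))))

  ⇒-antitone : ∀ {x x′} y → x ≼ x′ → x′ ⇒ y ≼ x ⇒ y
  ⇒-antitone {x} {x′} y p = ⇝→≼ (𝟙-greatest
    (subst (_≼ (x′ ⇒ y) ⇝ (x ⇒ y)) (≼→⇒ p) (ax-⇒ x x′ y)))

  ≼-weaken-⇒ : ∀ x y → y ≼ x ⇒ y
  ≼-weaken-⇒ x y = ≼-trans (mp-⇝ y y)
    (subst (λ a → a ⇒ y ≼ x ⇒ y) (sym (≼→⇝ (≼-refl y))) (⇒-antitone y (≼-top x)))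

dual : BoundedPseudoBCK → BoundedPseudoBCK
dual B = record
  { pbck = record
    { A = A ; _≼_ = _≼_ ; _⇒_ = _⇝_ ; _⇝_ = _⇒_ ; 𝟙 = 𝟙
    ; ax-⇒ = ax-⇝ ; ax-⇝ = ax-⇒ ; mp-⇒ = mp-⇝ ; mp-⇝ = mp-⇒
    ; ≼-refl = ≼-refl ; ≼-top = ≼-top ; ≼-antisym = ≼-antisym
    ; ≼→⇒ = ≼→⇝ ; ⇒→≼ = ⇝→≼ ; ≼→⇝ = ≼→⇒ ; ⇝→≼ = ⇒→≼
    }
  ; 𝟘 = 𝟘
  ; 𝟘-least = 𝟘-least
  }
  where open BoundedPseudoBCK B

dual-state : ∀ {Rl B s} → IsBosbachState Rl B s → IsBosbachState Rl (dual B) s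
dual-state st = record
  { s-≥0 = s-≥0 ; s-≤1 = s-≤1 ; bosbach-⇒ = bosbach-⇝ ; bosbach-⇝ = bosbach-⇒
  ; s-𝟘 = s-𝟘 ; s-𝟙 = s-𝟙
  }
  where open IsBosbachState st

module StateProperties {Rl : RealNumbers} {B : BoundedPseudoBCK}
  {s : BoundedPseudoBCK.A B → RealNumbers.ℝ Rl} (st : IsBosbachState Rl B s) where
  open RealNumbers Rl
  open RealProperties Rl
  open BoundedPseudoBCK B
  open PseudoBCKProperties (dual B)
    using () renaming (⇒-antitone to ⇝-antitone; ≼-weaken-⇒ to ≼-weaken-⇝)
  open PseudoBCKProperties B
  open IsBosbachState st

  ≼⇒s-⇒ : ∀ {x y} → x ≼ y → s (x ⇒ y) ≡ 1ℝ
  ≼⇒s-⇒ p = trans (cong s (≼→⇒ p)) s-𝟙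

  s-residual-⇝ : ∀ {x y} → y ≼ x → s x + s (x ⇝ y) ≡ s y + 1ℝ
  s-residual-⇝ {x} {y} p =
    trans (bosbach-⇝ x y) (cong (s y +_) (trans (cong s (≼→⇝ p)) s-𝟙))

  s-mono : ∀ {x y} → x ≼ y → s x ≤ s y
  s-mono {x} {y} p = +-cancelʳ-≤ 1ℝ
    (≤-trans (≤-reflexive (sym (s-residual-⇝ p))) (+-monoˡ-≤ (s y) (s-≤1 (y ⇝ x))))

  -- The states of `x ⇒ y` and `u ⇝ y` both add up with `s u` to `s y + 1`, and `x ≼ u`. Used for
  -- the `dual` algebra too, this gives equality and hence normality of the kernel.
  s-⇒≤s-⇝ : ∀ x y → s (x ⇒ y) ≤ s (x ⇝ y)
  s-⇒≤s-⇝ x y = ≤-trans (≤-reflexive s-x⇒y≡s-u⇝y) (s-mono (⇝-antitone y (mp-⇒ x y)))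
    where
    u = (x ⇒ y) ⇝ y

    s-x⇒y≡s-u⇝y : s (x ⇒ y) ≡ s (u ⇝ y)
    s-x⇒y≡s-u⇝y = +-cancelˡ-≡ (s u) (trans (+-comm _ _)
      (trans (s-residual-⇝ (≼-weaken-⇒ x y))
        (sym (s-residual-⇝ (≼-weaken-⇝ (x ⇒ y) y)))))

module _ {Rl : RealNumbers} {B : BoundedPseudoBCK}
  {s : BoundedPseudoBCK.A B → RealNumbers.ℝ Rl} (st : IsBosbachState Rl B s) where
  open RealNumbers Rl using (≤-antisym)
  open BoundedPseudoBCK B
  open PseudoBCKProperties B using (≼-weaken-⇒)
  open IsBosbachState st
  open StateProperties st

  bosbachAlgebra : BosbachAlgebra Rl
  bosbachAlgebra = record
    { C = A
    ; _⇒_ = _⇒_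
    ; _⇝_ = _⇝_
    ; s = s
    ; s≤1 = s-≤1
    ; s-swap = λ x y →
        ≤-antisym (s-⇒≤s-⇝ x y) (StateProperties.s-⇒≤s-⇝ (dual-state st) x y)
    ; bosbach = bosbach-⇒
    ; ≲-refl = λ x → ≼⇒s-⇒ (≼-refl x)
    ; ax-⇒ = λ x y z → ≼⇒s-⇒ (ax-⇒ x y z)
    ; ax-⇝ = λ x y z → ≼⇒s-⇒ (ax-⇝ x y z)
    ; mp-⇒ = λ x y → ≼⇒s-⇒ (mp-⇒ x y)
    ; mp-⇝ = λ x y → ≼⇒s-⇒ (mp-⇝ x y)
    ; ≲-weaken-⇒ = λ x y → ≼⇒s-⇒ (≼-weaken-⇒ x y)
    }

theorem3p20 : (Rl : RealNumbers) (B : BoundedPseudoBCK)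
    (s : BoundedPseudoBCK.A B → RealNumbers.ℝ Rl) →
    IsBosbachState Rl B s →
    IsMVAlgebra (Θ Rl B (Ker Rl B s))
    (λ a b → BoundedPseudoBCK._⇒_ B (BoundedPseudoBCK._∼ B a) b)
    (BoundedPseudoBCK._⁻ B) (BoundedPseudoBCK.𝟘 B)
    × IsArchimedean (Θ Rl B (Ker Rl B s))
    (λ a b → BoundedPseudoBCK._⇒_ B (BoundedPseudoBCK._∼ B a) b)
    (BoundedPseudoBCK._⁻ B) (BoundedPseudoBCK.𝟘 B)
    × IsMVState (Θ Rl B (Ker Rl B s))
    (λ a b → BoundedPseudoBCK._⇒_ B (BoundedPseudoBCK._∼ B a) b)
    (BoundedPseudoBCK._⁻ B) (BoundedPseudoBCK.𝟘 B) Rl s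
theorem3p20 Rl B s st = isMVAlgebra , isArchimedean , isMVState
  where
  open BoundedPseudoBCK B using (𝟘; 𝟘-least)
  open MV (bosbachAlgebra st) 𝟘 (λ x → StateProperties.≼⇒s-⇒ st (𝟘-least x))
    (IsBosbachState.s-𝟘 st)
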